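{- The class of diamond-weakly modular graphs is closed under gated amalgamation: if $G$ is a gated amalgam of two diamond-weakly modular graphs $G_1$ and $G_2$, then $G$ is diamond-weakly modular.
   Context: All graphs are finite, simple and connected; $d$ is the shortest-path distance and $I(a,b)=\{w: d(a,w)+d(w,b)=d(a,b)\}$. For $S\subseteq V(G)$ and a vertex $y$, a vertex $x\in S$ is a gate of $y$ in $S$ if $x\in I(y,w)$ for all $w\in S$; $S$ (or the subgraph it induces) is gated if every vertex has a gate in $S$. A graph $G$ is a gated amalgam of $G_1$ and $G_2$ if $G_1,G_2$ are gated subgraphs of $G$ with $G_1\cup G_2=G$, $G_1\cap G_2\ne\emptyset$, and there are no edges between $G_1\setminus G_2$ and $G_2\setminus G_1$ (equivalently, $G$ is obtained from $G_1$ and $G_2$ by identifying isomorphic gated subgraphs $H_1\subseteq G_1$, $H_2\subseteq G_2$). Quadrangle condition $(QC)$: for any four vertices $u,v,w,y$ with $d(v,y)=d(w,y)=1$ and $2=d(v,w)\le d(u,v)=d(u,w)=d(u,y)-1$, there exists a common neighbor $z$ of $v$ and $w$ with $d(u,z)=d(u,v)-1$. Triangle diamond condition $(TDC)$: for any three vertices $u,v,w$ with $1=d(v,w)<d(u,v)=d(u,w)$, there exists a common neighbor $z$ of $v$ and $w$ with $d(u,z)=d(u,v)-1$ such that $z$ is adjacent to every vertex $x$ with $d(x,v)=1$, $d(u,x)=d(u,v)-1$ and to every vertex $y$ with $d(y,w)=1$, $d(u,y)=d(u,w)-1$ (diamonds being $K_4$ minus an edge). A graph is diamond-weakly modular if it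 satisfies $(QC)$ and $(TDC)$. -}

module Defs where

open import Data.Fin using (Fin)
open import Data.Fin.Properties using (any?) renaming (_≟_ to _≟ᶠ_)
open import Data.Nat using (ℕ; zero; suc; _+_; _≤_; _<_; z≤n; s≤s)
open import Data.Product using (∃; ∃-syntax; _×_; _,_; proj₁; proj₂)
open import Data.Sum using (_⊎_)
open import Function.Definitions using (Injective)
open import Level using (0ℓ)
open import Relation.Binary using (Rel; Decidable; Symmetric; Irreflexive)
open import Relation.Binary.PropositionalEquality using (_≡_; _≢_; refl)
open import Relation.Nullary using (¬_; Dec; yes; no; contradiction)
open import Relation.Nullary.Decidable using (map′; _×-dec_)
open import Relation.Unary using (Pred; _∈_; _∉_)

Least : Pred ℕ 0ℓ → Pred ℕ 0ℓ
Least P k = P k × (∀ j → P j → k ≤ j)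

least : (P : Pred ℕ 0ℓ) → (∀ k → Dec (P k)) → ∀ n → P n → ∃ (Least P)
least P P? zero    p = 0 , p , λ _ _ → z≤n
least P P? (suc n) p with P? 0
... | yes p₀ = 0 , p₀ , λ _ _ → z≤n
... | no ¬p₀ with least (λ k → P (suc k)) (λ k → P? (suc k)) n p
...   | k , pk , min = suc k , pk ,
        λ { zero q → contradiction q ¬p₀ ; (suc j) q → s≤s (min j q) }

data Walk {V : Set} (R : Rel V 0ℓ) : ℕ → Rel V 0ℓ where
  []  : ∀ {u} → Walk R 0 u u
  _∷_ : ∀ {u v w k} → R u v → Walk R k v w → Walk R (suc k) u w

walk? : ∀ {n} {R : Rel (Fin n) 0ℓ} → Decidable R → ∀ k → Decidable (Walk R k)
walk? R? zero    u v = map′ (λ { refl → [] }) (λ { [] → refl }) (u ≟ᶠ v)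
walk? R? (suc k) u v =
  map′ (λ (_ , r , p) → r ∷ p) (λ { (r ∷ p) → _ , r , p })
       (any? λ w → R? u w ×-dec walk? R? k w v)

record Graph : Set₁ where
  field
    order     : ℕ
    Adj       : Rel (Fin order) 0ℓ
    adj?      : Decidable Adj
    symmetric : Symmetric Adj
    loopless  : Irreflexive _≡_ Adj
    connected : ∀ u v → ∃[ k ] Walk Adj k u v

  Vertex : Set
  Vertex = Fin order

  shortest : ∀ u v → ∃ (Least (λ k → Walk Adj k u v))
  shortest u v = least _ (λ k → walk? adj? k u v)
                         (proj₁ (connected u v)) (proj₂ (connected u v))

  d : Vertex → Vertex → ℕ
  d u v = proj₁ (shortest u v)

  I : Vertex → Vertex → Pred Vertex 0ℓ
  I a b w = d a w + d w b ≡ d a b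

  IsGate : Pred Vertex 0ℓ → Vertex → Vertex → Set
  IsGate S y x = x ∈ S × (∀ w → w ∈ S → x ∈ I y w)

  Gated : Pred Vertex 0ℓ → Set
  Gated S = ∀ y → ∃[ x ] IsGate S y x

  CommonNeighbor : Vertex → Vertex → Pred Vertex 0ℓ
  CommonNeighbor v w z = Adj z v × Adj z w

  -- Equations a = b - 1 between distances are written suc a ≡ b.
  QC : Set
  QC = ∀ u v w y →
       d v y ≡ 1 → d w y ≡ 1 →
       d v w ≡ 2 → 2 ≤ d u v → d u v ≡ d u w → suc (d u v) ≡ d u y →
       ∃[ z ] CommonNeighbor v w z × suc (d u z) ≡ d u v

  -- The vertex z itself is a neighbor of v and of w at distance d u v - 1
  -- from u, so the adjacency requirement concerns the vertices other than z.
  TDC : Set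
  TDC = ∀ u v w →
        d v w ≡ 1 → 1 < d u v → d u v ≡ d u w →
        ∃[ z ] CommonNeighbor v w z × suc (d u z) ≡ d u v
             × (∀ x → x ≢ z → d x v ≡ 1 → suc (d u x) ≡ d u v → Adj z x)
             × (∀ y → y ≢ z → d y w ≡ 1 → suc (d u y) ≡ d u w → Adj z y)

  DiamondWeaklyModular : Set
  DiamondWeaklyModular = QC × TDC

open Graph using (Vertex; Adj; Gated; DiamondWeaklyModular) public

-- H as an induced subgraph of G, up to the names of the vertices of H.
record InducedSubgraph (H G : Graph) : Set where
  field
    ι           : Vertex H → Vertex G
    ι-injective : Injective _≡_ _≡_ ι
    preserves   : ∀ {u v} → Adj H u v → Adj G (ι u) (ι v)
    reflects    : ∀ {u v} → Adj G (ι u) (ι v) → Adj H u v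

  vertices : Pred (Vertex G) 0ℓ
  vertices x = ∃[ i ] ι i ≡ x

-- As G₁ and G₂ are induced, cover and no-cross-edges together say that
-- G₁ ∪ G₂ = G holds for edges as well as for vertices.
record GatedAmalgam (G G₁ G₂ : Graph) : Set where
  field
    sub₁ : InducedSubgraph G₁ G
    sub₂ : InducedSubgraph G₂ G

  V₁ : Pred (Vertex G) 0ℓ
  V₁ = InducedSubgraph.vertices sub₁

  V₂ : Pred (Vertex G) 0ℓ
  V₂ = InducedSubgraph.vertices sub₂

  field
    gated₁         : Gated G V₁
    gated₂         : Gated G V₂
    cover          : ∀ x → x ∈ V₁ ⊎ x ∈ V₂
    intersect      : ∃[ x ] x ∈ V₁ × x ∈ V₂
    no-cross-edges : ∀ {x y} → x ∈ V₁ → x ∉ V₂ → y ∈ V₂ → y ∉ V₁ → ¬ Adj G x y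

{-# OPTIONS --safe #-}

-- Gated sets are convex, so each part of the amalgam is isometrically embedded,
-- and the gate u′ of u in a part S satisfies d u t = d u u′ + d u′ t for all t ∈ S.
-- An instance of (QC) or (TDC) whose vertices other than u lie in S therefore
-- reduces to the same instance in S with u replaced by u′; when u′ is already a
-- neighbour of v and w, it is itself the required common neighbour z.
-- If u is in one part, then every instance fits into a single part: an edge
-- leaving a gated set S increases the distance to each u ∈ S by exactly one, which
-- rules out the mixed cases.

module Submission where

open import Defs

open import Data.Fin.Properties using (any?) renaming (_≟_ to _≟ᶠ_)
open import Data.Nat using (suc; _+_; _≤_; _<_; z≤n; s≤s)
open import Data.Nat.Properties
open import Data.Nat.Solver using (module +-*-Solver)
open import Data.Product using (∃-syntax; _×_; _,_; proj₁; proj₂)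
open import Data.Sum using (inj₁; inj₂; swap)
open import Function using (_∘_)
open import Level using (0ℓ)
open import Relation.Binary using (Rel; Symmetric)
open import Relation.Binary.PropositionalEquality
open import Relation.Nullary using (Dec; yes; no; contradiction)
open import Relation.Nullary.Decidable using (decidable-stable)
open import Relation.Unary using (_∈_; _∉_)

-- Concatenation and reversal of walks.

module _ {V : Set} {R : Rel V 0ℓ} where

  _++ʷ_ : ∀ {k l u v w} → Walk R k u v → Walk R l v w → Walk R (k + l) u w
  []      ++ʷ q = q
  (r ∷ p) ++ʷ q = r ∷ (p ++ʷ q)

  reverseʷ : Symmetric R → ∀ {k u v} → Walk R k u v → Walk R k v u
  reverseʷ sy [] = []
  reverseʷ sy {suc k} {u} {v} (r ∷ p) =
    subst (λ l → Walk R l v u) (+-comm k 1) (reverseʷ sy p ++ʷ (sy r ∷ []))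

-- Shortest-path distance and gated sets.

module Metric (G : Graph) where
  open Graph G hiding (Vertex; Adj; Gated)

  geodesic : ∀ u v → Walk (Adj G) (d u v) u v
  geodesic u v = proj₁ (proj₂ (shortest u v))

  d-minimal : ∀ {k u v} → Walk (Adj G) k u v → d u v ≤ k
  d-minimal {k} {u} {v} = proj₂ (proj₂ (shortest u v)) k

  d-refl : ∀ u → d u u ≡ 0
  d-refl u = n≤0⇒n≡0 (d-minimal [])

  d≡0⇒≡ : ∀ {u v} → d u v ≡ 0 → u ≡ v
  d≡0⇒≡ {u} {v} eq with d u v | geodesic u v
  d≡0⇒≡ refl | _ | [] = refl

  d≡1⇒adj : ∀ {u v} → d u v ≡ 1 → Adj G u v
  d≡1⇒adj {u} {v} eq with d u v | geodesic u v
  d≡1⇒adj refl | _ | r ∷ [] = r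

  adj⇒d≡1 : ∀ {u v} → Adj G u v → d u v ≡ 1
  adj⇒d≡1 r = ≤-antisym (d-minimal (r ∷ []))
                        (n≢0⇒n>0 λ d≡0 → loopless (d≡0⇒≡ d≡0) r)

  d-sym : ∀ u v → d u v ≡ d v u
  d-sym u v = ≤-antisym (d-minimal (reverseʷ symmetric (geodesic v u)))
                        (d-minimal (reverseʷ symmetric (geodesic u v)))

  d-triangle : ∀ u v w → d u w ≤ d u v + d v w
  d-triangle u v w = d-minimal (geodesic u v ++ʷ geodesic v w)

  predecessor∈I : ∀ {u v x} → d x v ≡ 1 → suc (d u x) ≡ d u v → x ∈ I u v
  predecessor∈I {u} {v} {x} xv eq = trans (cong (d u x +_) xv) (trans (+-comm _ 1) eq)

  -- Passing through the gate g of x costs d x g twice on the way from a to b.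
  gated-convex : ∀ {S} → Gated G S → ∀ {a b x} → a ∈ S → b ∈ S → x ∈ I a b → x ∈ S
  gated-convex {S} gated {a} {b} {x} a∈S b∈S x∈I with gated x
  ... | g , g∈S , gate = subst (_∈ S) (sym (d≡0⇒≡ dxg≡0)) g∈S
    where
    open ≤-Reasoning
    open +-*-Solver
    e = d x g
    detour : (e + e) + d a b ≤ 0 + d a b
    detour = begin
      (e + e) + d a b             ≤⟨ +-monoʳ-≤ (e + e) (d-triangle a g b) ⟩
      (e + e) + (d a g + d g b)   ≡⟨ cong (λ t → (e + e) + (t + d g b)) (d-sym a g) ⟩
      (e + e) + (d g a + d g b)   ≡⟨ solve 3 (λ p q r → (p :+ p) :+ (q :+ r) := (p :+ q) :+ (p :+ r)) refl e (d g a) (d g b) ⟩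
      (e + d g a) + (e + d g b)   ≡⟨ cong₂ _+_ (gate a a∈S) (gate b b∈S) ⟩
      d x a + d x b               ≡⟨ cong (_+ d x b) (d-sym x a) ⟩
      d a x + d x b               ≡⟨ x∈I ⟩
      d a b                       ∎
    dxg≡0 : e ≡ 0
    dxg≡0 = m+n≡0⇒m≡0 e (n≤0⇒n≡0 (+-cancelʳ-≤ (d a b) (e + e) 0 detour))

  -- The gate `g` of `x` differs from `x`, as `x ∉ S`, and it lies between the adjacent vertices `x`
  -- and `y`. So `g` is `y`, and the gate equation at `u` gives the claim.
  gated-leaving-edge : ∀ {S} → Gated G S → ∀ {u x y} → u ∈ S → y ∈ S → x ∉ S →
                       d x y ≡ 1 → d u x ≡ suc (d u y)
  gated-leaving-edge {S} gated {u} {x} {y} u∈S y∈S x∉S xy with gated x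
  ... | g , g∈S , gate with d x g in xg | gate y y∈S | gate u u∈S
  ... | 0     | _  | _  = contradiction (subst (_∈ S) (sym (d≡0⇒≡ xg)) g∈S) x∉S
  ... | suc k | gy | gu = begin
      d u x           ≡⟨ d-sym u x ⟩
      d x u           ≡⟨ gu ⟨
      suc k + d g u   ≡⟨ cong₂ (λ m v → suc m + d v u) (m+n≡0⇒m≡0 k k+gy≡0) (d≡0⇒≡ (m+n≡0⇒n≡0 k k+gy≡0)) ⟩
      suc (d y u)     ≡⟨ cong suc (d-sym y u) ⟩
      suc (d u y)     ∎
    where
    open ≡-Reasoning
    k+gy≡0 : k + d g y ≡ 0
    k+gy≡0 = suc-injective (trans gy xy)

-- Isometry of a gated subgraph, and the two conditions inside it.

module GatedSubgraph {H G : Graph} (sub : InducedSubgraph H G)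
                     (gated : Gated G (InducedSubgraph.vertices sub)) where
  open InducedSubgraph sub
  open Graph G hiding (Vertex; Adj; Gated)
  open Graph H using () renaming (d to dᴴ; QC to QCᴴ; TDC to TDCᴴ)
  open Metric G
  module Mᴴ = Metric H

  vertices? : ∀ x → Dec (x ∈ vertices)
  vertices? x = any? λ i → ι i ≟ᶠ x

  mapʷ : ∀ {k i j} → Walk (Adj H) k i j → Walk (Adj G) k (ι i) (ι j)
  mapʷ []      = []
  mapʷ (r ∷ p) = preserves r ∷ mapʷ p

  -- Convexity keeps each next vertex of a geodesic in the subgraph. The bound `k ≤ d a b` expresses
  -- that the walk is a geodesic.
  geodesic-lifts : ∀ {k a b i j} → Walk (Adj G) k a b → ι i ≡ a → ι j ≡ b →
                   k ≤ d a b → Walk (Adj H) k i j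
  geodesic-lifts {i = i} [] ia jb _ =
    subst (Walk (Adj H) 0 i) (ι-injective (trans ia (sym jb))) []
  geodesic-lifts {suc k} {a} {b} (_∷_ {v = x} r p) refl refl long
    with gated-convex gated (_ , refl) (_ , refl) x∈I
    where
    ax : d a x ≡ 1
    ax = adj⇒d≡1 r
    x∈I : x ∈ I a b
    x∈I = ≤-antisym
      (≤-trans (≤-reflexive (cong (_+ d x b) ax)) (≤-trans (s≤s (d-minimal p)) long))
      (d-triangle a x b)
  ... | m , refl = reflects r ∷ geodesic-lifts p refl refl
    -- The tail is again a geodesic: `suc k ≤ d a b ≤ 1 + d x b`, and the first edge cancels.
    (+-cancelˡ-≤ 1 k _ (≤-trans long
      (≤-trans (d-triangle a x b) (≤-reflexive (cong (_+ d x b) (adj⇒d≡1 r))))))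

  isometric : ∀ i j → d (ι i) (ι j) ≡ dᴴ i j
  isometric i j = ≤-antisym
    (d-minimal (mapʷ (Mᴴ.geodesic i j)))
    (Mᴴ.d-minimal (geodesic-lifts (geodesic (ι i) (ι j)) refl refl ≤-refl))

  -- Here `p` names the gate of `u` in `H`. By `d-via`, distances from `u` and from `p` differ by a
  -- constant, so equalities and unit steps carry over both ways.
  record Projection (u : Vertex G) : Set where
    field
      p      : Vertex H
      d-via  : ∀ t → d u (ι t) ≡ d u (ι p) + dᴴ p t

    d-reflects-≡ : ∀ {s t} → d u (ι s) ≡ d u (ι t) → dᴴ p s ≡ dᴴ p t
    d-reflects-≡ {s} {t} eq =
      +-cancelˡ-≡ (d u (ι p)) _ _ (trans (sym (d-via s)) (trans eq (d-via t)))

    d-reflects-suc : ∀ {s t} → suc (d u (ι s)) ≡ d u (ι t) → suc (dᴴ p s) ≡ dᴴ p t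
    d-reflects-suc {s} {t} eq = +-cancelˡ-≡ (d u (ι p)) _ _
      (trans (+-suc _ _) (trans (cong suc (sym (d-via s))) (trans eq (d-via t))))

    d-preserves-suc : ∀ {s t} → suc (dᴴ p s) ≡ dᴴ p t → suc (d u (ι s)) ≡ d u (ι t)
    d-preserves-suc {s} {t} eq = trans (cong suc (d-via s))
      (trans (sym (+-suc _ _)) (trans (cong (d u (ι p) +_) eq) (sym (d-via t))))

    gate-precedes : ∀ {t} → dᴴ p t ≡ 1 → suc (d u (ι p)) ≡ d u (ι t)
    gate-precedes pt = d-preserves-suc (trans (cong suc (Mᴴ.d-refl p)) (sym pt))

  project : ∀ u → Projection u
  project u with gated u
  ... | _ , (p , refl) , gate = record
    { p = p
    ; d-via = λ t → trans (sym (gate (ι t) (t , refl)))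
                          (cong (d u (ι p) +_) (isometric p t))
    }

  QC-inside : QCᴴ → ∀ {u v w y} → v ∈ vertices → w ∈ vertices →
              d v y ≡ 1 → d w y ≡ 1 → d v w ≡ 2 → d u v ≡ d u w →
              suc (d u v) ≡ d u y →
              ∃[ z ] CommonNeighbor v w z × suc (d u z) ≡ d u v
  QC-inside qc {u} {y = y} (i , refl) (j , refl) vy wy vw uv≡uw uv<uy
    -- `y` is the midpoint of a geodesic from `v` to `w`, hence in the subgraph by convexity.
    with gated-convex gated {x = y} (i , refl) (j , refl)
           (trans (cong₂ _+_ vy (trans (d-sym y (ι j)) wy)) (sym vw))
  ... | l , refl = go (dᴴ p i) refl
    where
    open Projection (project u)
    ij : dᴴ i j ≡ 2
    ij = trans (sym (isometric i j)) vw
    pi≡pj : dᴴ p i ≡ dᴴ p j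
    pi≡pj = d-reflects-≡ uv≡uw
    go : ∀ k → dᴴ p i ≡ k → ∃[ z ] CommonNeighbor (ι i) (ι j) z × suc (d u z) ≡ d u (ι i)
    -- Otherwise `v` and `w` would both be the gate, though they are at distance 2.
    go 0 pi with Mᴴ.d≡0⇒≡ pi | Mᴴ.d≡0⇒≡ (trans (sym pi≡pj) pi)
    ... | refl | refl = contradiction (trans (sym (Mᴴ.d-refl p)) ij) λ ()
    go 1 pi = ι p
            , (preserves (Mᴴ.d≡1⇒adj pi) , preserves (Mᴴ.d≡1⇒adj (trans (sym pi≡pj) pi)))
            , gate-precedes pi
    go (suc (suc k)) pi
      with qc p i j l (trans (sym (isometric i l)) vy) (trans (sym (isometric j l)) wy) ij
              (subst (2 ≤_) (sym pi) (s≤s (s≤s z≤n))) pi≡pj (d-reflects-suc uv<uy)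
    ... | z , (zi , zj) , pz = ι z , (preserves zi , preserves zj) , d-preserves-suc pz

  -- The diamond clauses range over neighbours in all of `G`, while `tdcᴴ`-type information concerns
  -- vertices of `H` only. The two membership hypotheses bridge this gap.
  TDC-inside : TDCᴴ → ∀ {u v w} → v ∈ vertices → w ∈ vertices →
               (∀ x → d x v ≡ 1 → suc (d u x) ≡ d u v → x ∈ vertices) →
               (∀ y → d y w ≡ 1 → suc (d u y) ≡ d u w → y ∈ vertices) →
               d v w ≡ 1 → d u v ≡ d u w →
               ∃[ z ] CommonNeighbor v w z × suc (d u z) ≡ d u v
                    × (∀ x → x ≢ z → d x v ≡ 1 → suc (d u x) ≡ d u v → Adj G z x)
                    × (∀ y → y ≢ z → d y w ≡ 1 → suc (d u y) ≡ d u w → Adj G z y)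
  TDC-inside tdc {u} (i , refl) (j , refl) preds-v preds-w vw uv≡uw = go (dᴴ p i) refl
    where
    open Projection (project u)
    ij : dᴴ i j ≡ 1
    ij = trans (sym (isometric i j)) vw
    pi≡pj : dᴴ p i ≡ dᴴ p j
    pi≡pj = d-reflects-≡ uv≡uw

    -- A predecessor of `t` inside the subgraph is at distance 0 from `p`, so it is the gate itself
    -- and `x ≢ ι p` excludes it.
    gate-only-predecessor : ∀ {t} → dᴴ p t ≡ 1 →
      (∀ x → d x (ι t) ≡ 1 → suc (d u x) ≡ d u (ι t) → x ∈ vertices) →
      ∀ x → x ≢ ι p → d x (ι t) ≡ 1 → suc (d u x) ≡ d u (ι t) → Adj G (ι p) x
    gate-only-predecessor pt preds x x≢p xt ux with preds x xt ux
    ... | m , refl = contradiction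
      (cong ι (sym (Mᴴ.d≡0⇒≡ (suc-injective (trans (d-reflects-suc ux) pt))))) x≢p

    transfer : ∀ {t z} →
      (∀ x → x ≢ z → dᴴ x t ≡ 1 → suc (dᴴ p x) ≡ dᴴ p t → Adj H z x) →
      (∀ x → d x (ι t) ≡ 1 → suc (d u x) ≡ d u (ι t) → x ∈ vertices) →
      ∀ x → x ≢ ι z → d x (ι t) ≡ 1 → suc (d u x) ≡ d u (ι t) → Adj G (ι z) x
    transfer adj preds x x≢z xt ux with preds x xt ux
    ... | m , refl = preserves
      (adj m (x≢z ∘ cong ι) (trans (sym (isometric m _)) xt) (d-reflects-suc ux))

    go : ∀ k → dᴴ p i ≡ k →
         ∃[ z ] CommonNeighbor (ι i) (ι j) z × suc (d u z) ≡ d u (ι i)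
              × (∀ x → x ≢ z → d x (ι i) ≡ 1 → suc (d u x) ≡ d u (ι i) → Adj G z x)
              × (∀ y → y ≢ z → d y (ι j) ≡ 1 → suc (d u y) ≡ d u (ι j) → Adj G z y)
    go 0 pi with Mᴴ.d≡0⇒≡ pi | Mᴴ.d≡0⇒≡ (trans (sym pi≡pj) pi)
    ... | refl | refl = contradiction (trans (sym (Mᴴ.d-refl p)) ij) λ ()
    go 1 pi = ι p
            , (preserves (Mᴴ.d≡1⇒adj pi) , preserves (Mᴴ.d≡1⇒adj pj))
            , gate-precedes pi
            , gate-only-predecessor pi preds-v
            , gate-only-predecessor pj preds-w
      where
      pj : dᴴ p j ≡ 1
      pj = trans (sym pi≡pj) pi
    go (suc (suc k)) pi
      with tdc p i j ij (subst (1 <_) (sym pi) (s≤s (s≤s z≤n))) pi≡pj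
    ... | z , (zi , zj) , pz , adj-i , adj-j =
      ι z , (preserves zi , preserves zj) , d-preserves-suc pz
          , transfer adj-i preds-v , transfer adj-j preds-w

-- Placing an instance in one part of the amalgam.

amalgam-swap : ∀ {G G₁ G₂} → GatedAmalgam G G₁ G₂ → GatedAmalgam G G₂ G₁
amalgam-swap {G} A = record
  { sub₁ = sub₂ ; sub₂ = sub₁ ; gated₁ = gated₂ ; gated₂ = gated₁
  ; cover = λ x → swap (cover x)
  ; intersect = let x , x∈₁ , x∈₂ = intersect in x , x∈₂ , x∈₁
  ; no-cross-edges = λ x∈₂ x∉₁ y∈₁ y∉₂ xy →
      no-cross-edges y∈₁ y∉₂ x∈₂ x∉₁ (Graph.symmetric G xy)
  }
  where open GatedAmalgam A

module FromFirstPart {G G₁ G₂ : Graph} (A : GatedAmalgam G G₁ G₂) where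
  open GatedAmalgam A
  open Graph G hiding (Vertex; Adj; Gated)
  open Metric G
  module S₁ = GatedSubgraph sub₁ gated₁
  module S₂ = GatedSubgraph sub₂ gated₂

  ∉V₁⇒∈V₂ : ∀ {x} → x ∉ V₁ → x ∈ V₂
  ∉V₁⇒∈V₂ {x} x∉₁ with cover x
  ... | inj₁ x∈₁ = contradiction x∈₁ x∉₁
  ... | inj₂ x∈₂ = x∈₂

  neighbour-∉V₁⇒∈V₂ : ∀ {x y} → x ∉ V₁ → d y x ≡ 1 → y ∈ V₂
  neighbour-∉V₁⇒∈V₂ {x} {y} x∉₁ yx with cover y
  ... | inj₂ y∈₂ = y∈₂
  -- The ban on cross edges only refutes `y ∉ V₂`; membership is decidable by finite search, so the
  -- double negation can be removed.
  ... | inj₁ y∈₁ = decidable-stable (S₂.vertices? y) λ y∉₂ →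
    no-cross-edges y∈₁ y∉₂ (∉V₁⇒∈V₂ x∉₁) x∉₁ (d≡1⇒adj yx)

  neighbour-no-farther⇒∈V₁ : ∀ {u x y} → u ∈ V₁ → y ∈ V₁ → d x y ≡ 1 →
                             d u x ≤ d u y → x ∈ V₁
  neighbour-no-farther⇒∈V₁ {u} {x} {y} u∈ y∈ xy ux≤uy =
    decidable-stable (S₁.vertices? x) λ x∉ →
      <⇒≱ (≤-reflexive (sym (gated-leaving-edge gated₁ u∈ y∈ x∉ xy))) ux≤uy

  -- The side of `y`, the vertex farthest from `u`, decides. If `y` is in `V₁`, its neighbours `v`
  -- and `w` are nearer to `u` and cannot lie outside; if not, all neighbours of `y` are in `V₂`.
  QC-from : Graph.QC G₁ → Graph.QC G₂ → ∀ {u} → u ∈ V₁ → ∀ v w y →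
            d v y ≡ 1 → d w y ≡ 1 →
            d v w ≡ 2 → d u v ≡ d u w → suc (d u v) ≡ d u y →
            ∃[ z ] CommonNeighbor v w z × suc (d u z) ≡ d u v
  QC-from qc₁ qc₂ {u} u∈ v w y vy wy vw uv≡uw uv<uy with S₁.vertices? y
  ... | yes y∈ = S₁.QC-inside qc₁
    (neighbour-no-farther⇒∈V₁ u∈ y∈ vy uv≤uy)
    (neighbour-no-farther⇒∈V₁ u∈ y∈ wy (subst (_≤ d u y) uv≡uw uv≤uy))
    vy wy vw uv≡uw uv<uy
    where
    uv≤uy : d u v ≤ d u y
    uv≤uy = <⇒≤ (≤-reflexive uv<uy)
  ... | no y∉ = S₂.QC-inside qc₂
    (neighbour-∉V₁⇒∈V₂ y∉ vy) (neighbour-∉V₁⇒∈V₂ y∉ wy) vy wy vw uv≡uw uv<uy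

  -- As `v` and `w` are equally far from `u`, the edge between them does not leave `V₁`, so both are
  -- in `V₁` or both outside. Predecessors of `v` and `w` are kept in `V₁` by convexity in the first
  -- case, and in `V₂` by the absence of cross edges in the second.
  TDC-from : Graph.TDC G₁ → Graph.TDC G₂ → ∀ {u} → u ∈ V₁ → ∀ v w →
             d v w ≡ 1 → d u v ≡ d u w →
             ∃[ z ] CommonNeighbor v w z × suc (d u z) ≡ d u v
                  × (∀ x → x ≢ z → d x v ≡ 1 → suc (d u x) ≡ d u v → Adj G z x)
                  × (∀ y → y ≢ z → d y w ≡ 1 → suc (d u y) ≡ d u w → Adj G z y)
  TDC-from tdc₁ tdc₂ {u} u∈ v w vw uv≡uw with S₁.vertices? v
  ... | yes v∈ = S₁.TDC-inside tdc₁ v∈ w∈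
    (λ x xv ux → gated-convex gated₁ u∈ v∈ (predecessor∈I xv ux))
    (λ y yw uy → gated-convex gated₁ u∈ w∈ (predecessor∈I yw uy))
    vw uv≡uw
    where
    w∈ : w ∈ V₁
    w∈ = neighbour-no-farther⇒∈V₁ u∈ v∈ (trans (d-sym w v) vw) (≤-reflexive (sym uv≡uw))
  ... | no v∉ = S₂.TDC-inside tdc₂ (∉V₁⇒∈V₂ v∉) (∉V₁⇒∈V₂ w∉)
    (λ x xv _ → neighbour-∉V₁⇒∈V₂ v∉ xv)
    (λ y yw _ → neighbour-∉V₁⇒∈V₂ w∉ yw)
    vw uv≡uw
    where
    w∉ : w ∉ V₁
    w∉ w∈ = v∉ (neighbour-no-farther⇒∈V₁ u∈ w∈ vw (≤-reflexive uv≡uw))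

theorem2 : (G G₁ G₂ : Graph) → GatedAmalgam G G₁ G₂ → DiamondWeaklyModular G₁ → DiamondWeaklyModular G₂ → DiamondWeaklyModular G
theorem2 G G₁ G₂ A (qc₁ , tdc₁) (qc₂ , tdc₂) = qc , tdc
  where
  module F₁ = FromFirstPart A
  module F₂ = FromFirstPart (amalgam-swap A)

  qc : Graph.QC G
  qc u v w y vy wy vw _ uv≡uw uv<uy with GatedAmalgam.cover A u
  ... | inj₁ u∈ = F₁.QC-from qc₁ qc₂ u∈ v w y vy wy vw uv≡uw uv<uy
  -- Exchanging the two parts makes the one containing `u` the first.
  ... | inj₂ u∈ = F₂.QC-from qc₂ qc₁ u∈ v w y vy wy vw uv≡uw uv<uy

  tdc : Graph.TDC G
  tdc u v w vw _ uv≡uw with GatedAmalgam.cover A u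
  ... | inj₁ u∈ = F₁.TDC-from tdc₁ tdc₂ u∈ v w vw uv≡uw
  ... | inj₂ u∈ = F₂.TDC-from tdc₂ tdc₁ u∈ v w vw uv≡uw
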